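{- Let $\precsim$ be a C-quasi-order on a group $G$. Then there is only one compatible C-relation on $G$ inducing it, namely the one given by the formula $C(x,y,z)\Leftrightarrow yz^{ -1}\precnsim xz^{ -1}$.
   Context: A quasi-order is a reflexive, transitive and total binary relation $\precsim$; $a\sim b$ means $a\precsim b\precsim a$, and $a\precnsim b$ means $a\precsim b$ and $a\nsim b$. A C-relation on a set is a ternary relation $C$ such that for all $x,y,z,w$: $C(x,y,z)\Rightarrow C(x,z,y)$; $C(x,y,z)\Rightarrow\neg C(y,x,z)$; $C(x,y,z)\Rightarrow C(w,y,z)\vee C(x,w,z)$; $x\neq y\Rightarrow C(x,y,y)$. On a group it is compatible if $C(x,y,z)$ implies $C(vxu,vyu,vzu)$ for all $x,y,z,u,v$. The quasi-order induced by a compatible C-relation $C$ on a group is $x\precsim y\Leftrightarrow\neg C(x,y,1)$. A C-quasi-order on a group is a quasi-order induced in this way by some compatible C-relation. -}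

module Defs where

open import Algebra.Bundles using (Group)
open import Data.Product using (Σ-syntax; _×_)
open import Data.Sum using (_⊎_)
open import Function.Bundles using (_⇔_)
open import Level using (Level; _⊔_; suc)
open import Relation.Binary.Core using (Rel)
open import Relation.Binary.Structures using (IsTotalPreorder)
open import Relation.Nullary using (¬_)

Rel₃ : ∀ {a} → Set a → (r : Level) → Set (a ⊔ suc r)
Rel₃ A r = A → A → A → Set r

module _ {a r} {A : Set a} (_≾_ : Rel A r) where

  Equiv : Rel A r
  Equiv x y = x ≾ y × y ≾ x

  Strict : Rel A r
  Strict x y = x ≾ y × ¬ Equiv x y

module _ {c ℓ} (G : Group c ℓ) where

  open Group G

  record IsCRelation {r} (C : Rel₃ Carrier r) : Set (c ⊔ ℓ ⊔ r) where
    field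
      -- Equality of group elements is the setoid equality _≈_, so a relation
      -- on the group has to be invariant under it.
      resp-≈  : ∀ {x x′ y y′ z z′} → x ≈ x′ → y ≈ y′ → z ≈ z′ →
                C x y z → C x′ y′ z′
      swap    : ∀ x y z → C x y z → C x z y
      asym    : ∀ x y z → C x y z → ¬ C y x z
      split   : ∀ x y z w → C x y z → C w y z ⊎ C x w z
      nontriv : ∀ x y → ¬ (x ≈ y) → C x y y

  record IsCompatibleCRelation {r} (C : Rel₃ Carrier r) : Set (c ⊔ ℓ ⊔ r) where
    field
      isCRelation : IsCRelation C
      compatible  : ∀ x y z u v → C x y z →
                    C (v ∙ x ∙ u) (v ∙ y ∙ u) (v ∙ z ∙ u)

  Induces : ∀ {r} → Rel₃ Carrier r → Rel Carrier r → Set (c ⊔ r)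
  Induces C _≾_ = ∀ x y → x ≾ y ⇔ (¬ C x y ε)

  -- IsTotalPreorder is the notion of quasi-order here: reflexive, transitive
  -- and total.
  record IsCQuasiOrder {r} (_≾_ : Rel Carrier r) : Set (c ⊔ ℓ ⊔ suc r) where
    field
      isQuasiOrder : IsTotalPreorder _≈_ _≾_
      induced      : Σ[ C ∈ Rel₃ Carrier r ] IsCompatibleCRelation C × Induces C _≾_

  strictC : ∀ {r} → Rel Carrier r → Rel₃ Carrier r
  strictC _≾_ x y z = Strict _≾_ (y ∙ z ⁻¹) (x ∙ z ⁻¹)

{-# OPTIONS --safe #-}
-- Translating by z⁻¹ on the right turns C(x,y,z) into C(xz⁻¹,yz⁻¹,1), and
-- C(a,b,1) means that a ≾ b fails.
module Submission where

open import Defs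
open import Algebra.Bundles using (Group)
import Algebra.Properties.Group as GroupProperties
open import Axiom.ExcludedMiddle using (ExcludedMiddle)
open import Data.Product using (_×_; _,_)
import Data.Sum as Sum
open import Function.Base using (_∘_)
open import Function.Bundles using (_⇔_; mk⇔; module Equivalence)
open import Function.Construct.Composition using (_⇔-∘_)
open import Relation.Binary.Core using (Rel)
open import Relation.Nullary.Decidable.Core using (decidable-stable)

open Equivalence using (to; from)

-- If `C` induces `_≾_`, then failure of a ≾ b is C(a,b,1). Asymmetry forbids C(a,b,1) and C(b,a,1)
-- together, so C(a,b,1) holds exactly when b lies strictly below a (`C-ε⇔Strict`). Compatibility
-- reduces every triple to this case (`translate-to-ε`), so `_≾_` determines `C` by the formula
-- (`C⇔strictC`). Applied to an arbitrary inducing relation this is uniqueness; applied to the one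
-- that the hypothesis supplies, it carries all its properties over to `strictC`.

module _ {c ℓ} (G : Group c ℓ) where

  open Group G
  open GroupProperties G using (//-rightDividesˡ)

  module _ {r s} {C : Rel₃ Carrier r} {D : Rel₃ Carrier s}
           (C⇔D : ∀ x y z → C x y z ⇔ D x y z) where

    private
      C⇒D : ∀ {x y z} → C x y z → D x y z
      C⇒D = to (C⇔D _ _ _)

      D⇒C : ∀ {x y z} → D x y z → C x y z
      D⇒C = from (C⇔D _ _ _)

    -- Lets `strictC` inherit the axioms from a relation already known to satisfy them, instead of
    -- verifying them from the formula.
    isCRelation-resp-⇔ : IsCRelation G C → IsCRelation G D
    isCRelation-resp-⇔ isC = record
      { resp-≈  = λ p q t → C⇒D ∘ resp-≈ p q t ∘ D⇒C
      ; swap    = λ x y z → C⇒D ∘ swap x y z ∘ D⇒C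
      ; asym    = λ x y z d → asym x y z (D⇒C d) ∘ D⇒C
      ; split   = λ x y z w → Sum.map C⇒D C⇒D ∘ split x y z w ∘ D⇒C
      ; nontriv = λ x y → C⇒D ∘ nontriv x y
      }
      where open IsCRelation isC

    isCompatibleCRelation-resp-⇔ :
      IsCompatibleCRelation G C → IsCompatibleCRelation G D
    isCompatibleCRelation-resp-⇔ isCompat = record
      { isCRelation = isCRelation-resp-⇔ isCRelation
      ; compatible  = λ x y z u v → C⇒D ∘ compatible x y z u v ∘ D⇒C
      }
      where open IsCompatibleCRelation isCompat

  induces-resp-⇔ : ∀ {r} {C D : Rel₃ Carrier r} {_≾_ : Rel Carrier r} →
    (∀ x y z → C x y z ⇔ D x y z) → Induces G C _≾_ → Induces G D _≾_
  induces-resp-⇔ C⇔D ind x y = mk⇔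
    (λ x≾y → to (ind x y) x≾y ∘ from (C⇔D _ _ _))
    (λ ¬d → from (ind x y) (¬d ∘ to (C⇔D _ _ _)))

  module _ {r} {C : Rel₃ Carrier r} (isCompat : IsCompatibleCRelation G C) where

    open IsCompatibleCRelation isCompat
    open IsCRelation isCRelation

    translate-to-ε : ∀ x y z → C x y z ⇔ C (x ∙ z ⁻¹) (y ∙ z ⁻¹) ε
    translate-to-ε x y z = mk⇔
      -- Compatibility is two-sided; only right multiplication is wanted, so the left factor is `ε`,
      -- which `resp-≈` then removes.
      (resp-≈ (∙-congʳ (identityˡ x)) (∙-congʳ (identityˡ y))
              (trans (∙-congʳ (identityˡ z)) (inverseʳ z))
        ∘ compatible x y z (z ⁻¹) ε)
      (resp-≈ (cancel x) (cancel y) (trans (∙-congʳ (identityˡ ε)) (identityˡ z))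
        ∘ compatible (x ∙ z ⁻¹) (y ∙ z ⁻¹) ε z ε)
      where
      cancel : ∀ w → ε ∙ (w ∙ z ⁻¹) ∙ z ≈ w
      cancel w = trans (∙-congʳ (identityˡ _)) (//-rightDividesˡ z w)

    module _ (em : ExcludedMiddle r) {_≾_ : Rel Carrier r}
             (ind : Induces G C _≾_) where

      C-ε⇔Strict : ∀ a b → C a b ε ⇔ Strict _≾_ b a
      C-ε⇔Strict a b = mk⇔
        (λ c → from (ind b a) (asym a b ε c) , λ (_ , a≾b) → to (ind a b) a≾b c)
        -- `_≾_` only records the negation of `C`, so recovering `C` itself takes double negation
        -- elimination.
        (λ (b≾a , b≁a) → decidable-stable em λ ¬c → b≁a (b≾a , from (ind a b) ¬c))

      C⇔strictC : ∀ x y z → C x y z ⇔ strictC G _≾_ x y z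
      C⇔strictC x y z = C-ε⇔Strict _ _ ⇔-∘ translate-to-ε x y z

proposition2p4 : ∀ {c ℓ r} → ExcludedMiddle r →
    (G : Group c ℓ) (let open Group G)
    (_≾_ : Rel Carrier r) → IsCQuasiOrder G _≾_ →
    (IsCompatibleCRelation G (strictC G _≾_) × Induces G (strictC G _≾_) _≾_)
    × (∀ (C : Rel₃ Carrier r) → IsCompatibleCRelation G C → Induces G C _≾_ →
    ∀ x y z → C x y z ⇔ strictC G _≾_ x y z)
proposition2p4 em G _≾_ isCQO with IsCQuasiOrder.induced isCQO
... | C , isCompat , ind =
  -- Existence is transported from the given `C`; uniqueness applies the same equivalence to each
  -- `D`.
  (isCompatibleCRelation-resp-⇔ G C⇔strict isCompat , induces-resp-⇔ G C⇔strict ind)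
  , λ D isCompatD → C⇔strictC G isCompatD em
  where
  C⇔strict : ∀ x y z → C x y z ⇔ strictC G _≾_ x y z
  C⇔strict = C⇔strictC G isCompat em ind
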